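{- Let $A$ be any formula of $\mathbf{L_1}$. Every normal tableau for $A$ is finite (any process of extending branches of a tableau for $A$ by normal rule applications terminates after finitely many steps), and in a completed normal tableau for $A$ every branch ends either with a formula of the form $F[B_+,B_-]$ or with a Hintikka formula.
   Context: Formulas of $\mathbf{L_1}$: built from atomic formulas $\epsilon ab$ ($a,b$ name variables from a countably infinite list, possibly equal) with connectives $\vee,\sim$. Disjunctions may be associated in any way. Positive/negative parts (occurrences): $A$ is a positive part of $A$; if $B\vee C$ is a positive part then $B,C$ are positive parts; if $\sim B$ is a positive part then $B$ is a negative part; if $\sim B$ is a negative part then $B$ is a positive part. $F[B_+]$ ($G[B_-]$) denotes a formula with a specified occurrence of $B$ as positive (negative) part; $F[B_+,C_-]$ etc. denote specified non-overlapping occurrences. Tableaux: reduction rules ($\vee_-$) $G[B\vee C_-]$ $\mapsto$ two branches $G[B\vee C_-]\vee\sim B$, $G[B\vee C_-]\vee\sim C$; ($\epsilon_1$) $G[\epsilon ab_-]\mapsto G[\epsilon ab_-]\vee\sim\epsilon aa$; ($\epsilon_2$) $G[\epsilon ab_-,\epsilon bc_-]\mapsto G[\epsilon ab_-,\epsilon bc_-]\vee\sim\epsilon ac$; ($\epsilon_{3b}$) $G[\epsilon ab_-,\epsilon bb_-]\mapsto G[\epsilon ab_-,\epsilon bb_-]\vee\sim\epsilon ba$. A tableau for $A$ is a finite tree with root $A$ whose non-leaf nodes have as children the result of applying one rule to it. A tableau is normal if each rule application is made only to a formula not of the form $F[B_+,B_-]$ and only when the formula appended after $\sim$ (i.e.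 $B$, $C$, $\epsilon aa$, $\epsilon ac$ or $\epsilon ba$ respectively) does not already occur as a negative part of the formula being reduced. A normal tableau is completed if no further normal rule application is possible at the end of any branch. Hintikka formula: a formula $H$ such that (1) $H$ is not of the form $F[B_+,B_-]$; (2) if $B\vee C$ is a negative part of $H$ then $B$ or $C$ is; (3) if $\epsilon ab$ is a negative part then so is $\epsilon aa$; (4) if $\epsilon ab,\epsilon bc$ are negative parts then so is $\epsilon ac$; (5) if $\epsilon ab,\epsilon bb$ are negative parts then so is $\epsilon ba$. -}

module Defs where

open import Data.List.Base using (List; []; _∷_; [_])
open import Data.List.Relation.Unary.All using (All; []; _∷_; universal)
open import Data.Nat.Base using (ℕ)
open import Data.Product.Base using (Σ-syntax; ∃-syntax; _×_)
open import Data.Sign.Base using (Sign; +; -)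
open import Data.Sum.Base using (_⊎_)
open import Relation.Nullary.Negation.Core using (¬_)

Name : Set
Name = ℕ

infixr 6 _∨_
infix  7 ∼_
infix  4 _≈_ _⊑_ _⟶_ _⟶ₐ_

data Formula : Set where
  ε   : Name → Name → Formula
  _∨_ : Formula → Formula → Formula
  ∼_  : Formula → Formula

variable
  a b c : Name
  A A′ B B′ C C′ D G H : Formula
  Ds : List Formula
  s t : Sign

-- Disjunctions may be associated in any way, so a formula is a binary tree
-- up to reassociation of ∨ at any depth.  All notions below that concern a
-- formula A refer to an arbitrary tree G with A ≈ G.
data _≈_ : Formula → Formula → Set where
  ≈-refl  : A ≈ A
  ≈-sym   : A ≈ B → B ≈ A
  ≈-trans : A ≈ B → B ≈ C → A ≈ C
  ∨-assoc : (A ∨ B) ∨ C ≈ A ∨ (B ∨ C)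
  ∨-cong  : A ≈ A′ → B ≈ B′ → A ∨ B ≈ A′ ∨ B′
  ∼-cong  : A ≈ A′ → ∼ A ≈ ∼ A′

-- Occ s B G is the type of occurrences of B as a part of sign s in the tree G.
-- A part of a given tree is derived in exactly one way along the path leading
-- to it, so distinct elements are distinct occurrences.
data Occ : Sign → Formula → Formula → Set where
  here : Occ + A A
  ∨ˡ   : Occ + (B ∨ C) A → Occ + B A
  ∨ʳ   : Occ + (B ∨ C) A → Occ + C A
  ∼₊   : Occ + (∼ B) A → Occ - B A
  ∼₋   : Occ - (∼ B) A → Occ + B A

-- p ⊑ q : the occurrence p lies inside the occurrence q.
data _⊑_ {A : Formula} : Occ s B A → Occ t C A → Set where
  ⊑-refl : {p : Occ s B A} → p ⊑ p
  ⊑-∨ˡ   : {p : Occ + (B ∨ C) A} {q : Occ t D A} → p ⊑ q → ∨ˡ p ⊑ q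
  ⊑-∨ʳ   : {p : Occ + (B ∨ C) A} {q : Occ t D A} → p ⊑ q → ∨ʳ p ⊑ q
  ⊑-∼₊   : {p : Occ + (∼ B) A} {q : Occ t D A} → p ⊑ q → ∼₊ p ⊑ q
  ⊑-∼₋   : {p : Occ - (∼ B) A} {q : Occ t D A} → p ⊑ q → ∼₋ p ⊑ q

-- Two subtrees overlap exactly when one lies inside the other.
NonOverlapping : Occ s B A → Occ t C A → Set
NonOverlapping p q = ¬ (p ⊑ q) × ¬ (q ⊑ p)

Occ₂ : Sign → Formula → Sign → Formula → Formula → Set
Occ₂ s B t C G = Σ[ p ∈ Occ s B G ] Σ[ q ∈ Occ t C G ] NonOverlapping p q

Part : Sign → Formula → Formula → Set
Part s B A = ∃[ G ] (A ≈ G × Occ s B G)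

-- A is of the form F[B₊,B₋].
Closed : Formula → Set
Closed A = ∃[ B ] ∃[ G ] (A ≈ G × Occ₂ + B - B G)

-- Rule G Ds : a reduction rule applies to G, and its results are the formulas
-- G ∨ ∼ D, one branch for each D in Ds.
data Rule (G : Formula) : List Formula → Set where
  ∨₋  : Occ - (B ∨ C) G → Rule G (B ∷ C ∷ [])
  ε₁  : Occ - (ε a b) G → Rule G [ ε a a ]
  ε₂  : Occ₂ - (ε a b) - (ε b c) G → Rule G [ ε a c ]
  ε₃b : Occ₂ - (ε a b) - (ε b b) G → Rule G [ ε b a ]

data Tableau (A : Formula) : Set where
  leaf : Tableau A
  node : A ≈ G → Rule G Ds → All (λ D → Tableau (G ∨ ∼ D)) Ds → Tableau A

-- The side condition for reducing A by a rule that appends ∼ D for D in Ds.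
NormalFor : Formula → List Formula → Set
NormalFor A Ds = ¬ Closed A × All (λ D → ¬ Part - D A) Ds

data Normal {A : Formula} : Tableau A → Set
data AllNormal {G : Formula} : All (λ D → Tableau (G ∨ ∼ D)) Ds → Set

data Normal {A} where
  leaf : Normal leaf
  node : {e : A ≈ G} {r : Rule G Ds} {ts : All (λ D → Tableau (G ∨ ∼ D)) Ds} →
         NormalFor A Ds → AllNormal ts → Normal (node e r ts)

data AllNormal {G} where
  []  : AllNormal []
  _∷_ : {T : Tableau (G ∨ ∼ D)} {ts : All (λ D → Tableau (G ∨ ∼ D)) Ds} →
        Normal T → AllNormal ts → AllNormal (T ∷ ts)

-- T ⟶ T′ : T′ arises from T by one normal rule application at the end of
-- one branch.
data _⟶_ {A : Formula} : Tableau A → Tableau A → Set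
data _⟶ₐ_ {G : Formula} : (ts ts′ : All (λ D → Tableau (G ∨ ∼ D)) Ds) → Set

data _⟶_ {A} where
  extend : (e : A ≈ G) (r : Rule G Ds) → NormalFor A Ds →
           leaf ⟶ node e r (universal (λ _ → leaf) Ds)
  below  : {e : A ≈ G} {r : Rule G Ds} {ts ts′ : All (λ D → Tableau (G ∨ ∼ D)) Ds} →
           ts ⟶ₐ ts′ → node e r ts ⟶ node e r ts′

data _⟶ₐ_ {G} where
  here  : {T T′ : Tableau (G ∨ ∼ D)} {ts : All (λ D → Tableau (G ∨ ∼ D)) Ds} →
          T ⟶ T′ → (T ∷ ts) ⟶ₐ (T′ ∷ ts)
  there : {T : Tableau (G ∨ ∼ D)} {ts ts′ : All (λ D → Tableau (G ∨ ∼ D)) Ds} →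
          ts ⟶ₐ ts′ → (T ∷ ts) ⟶ₐ (T ∷ ts′)

-- BranchEnd H T : some branch of T ends with H.
data BranchEnd (H : Formula) : {A : Formula} → Tableau A → Set
data AnyBranchEnd (H : Formula) {G : Formula} : All (λ D → Tableau (G ∨ ∼ D)) Ds → Set

data BranchEnd H where
  leaf : BranchEnd H {H} leaf
  node : {e : A ≈ G} {r : Rule G Ds} {ts : All (λ D → Tableau (G ∨ ∼ D)) Ds} →
         AnyBranchEnd H ts → BranchEnd H (node e r ts)

data AnyBranchEnd H {G} where
  here  : {T : Tableau (G ∨ ∼ D)} {ts : All (λ D → Tableau (G ∨ ∼ D)) Ds} →
          BranchEnd H T → AnyBranchEnd H (T ∷ ts)
  there : {T : Tableau (G ∨ ∼ D)} {ts : All (λ D → Tableau (G ∨ ∼ D)) Ds} →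
          AnyBranchEnd H ts → AnyBranchEnd H (T ∷ ts)

NormallyReducible : Formula → Set
NormallyReducible H = ∃[ G ] ∃[ Ds ] (H ≈ G × Rule G Ds × NormalFor H Ds)

CompletedNormal : Tableau A → Set
CompletedNormal T = Normal T × (∀ H → BranchEnd H T → ¬ NormallyReducible H)

record Hintikka (H : Formula) : Set where
  field
    notClosed : ¬ Closed H
    ∨-neg     : ∀ B C → Part - (B ∨ C) H → Part - B H ⊎ Part - C H
    ε₁-neg    : ∀ a b → Part - (ε a b) H → Part - (ε a a) H
    ε₂-neg    : ∀ a b c → Part - (ε a b) H → Part - (ε b c) H → Part - (ε a c) H
    ε₃b-neg   : ∀ a b → Part - (ε a b) H → Part - (ε b b) H → Part - (ε b a) H

{-# OPTIONS --safe #-}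

-- Reassociation preserves the weight of a formula, and only finitely many
-- formulas have weight at most n; hence parthood and closedness are decidable.
-- Rule applications never raise the bound on the weights of negative parts,
-- and a normal one turns a formula within this bound into a new negative part,
-- so branches cannot grow forever.  At the end of a completed branch
-- decidability turns the failure of every normal rule application into the
-- Hintikka conditions; for the two-premise rules one needs that negative atoms
-- survive reassociation and overlap only if they are equal.
module Submission where

open import Defs
open import Data.List.Base using (List; []; _∷_; [_]; _++_; map; filter; length; upTo; cartesianProductWith)
open import Data.List.Membership.Propositional using (_∈_; lose)
open import Data.List.Membership.Propositional.Properties using (∈-++⁺ˡ; ∈-++⁺ʳ; ∈-map⁺; ∈-filter⁺; ∈-upTo⁺; ∈-cartesianProductWith⁺)
open import Data.List.Properties using (filter-notAll)
open import Data.List.Relation.Unary.All using (All; []; _∷_; universal)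
import Data.List.Relation.Unary.All as All
open import Data.List.Relation.Unary.All.Properties using (¬Any⇒All¬)
open import Data.List.Relation.Unary.Any using (Any; here; there; any?; satisfied)
open import Data.Nat.Base using (ℕ; zero; suc; _≤_; _<_; _⊔_; z≤n; s≤s)
import Data.Nat.Base as ℕ
import Data.Nat.Properties as ℕₚ
open import Data.Product.Base using (_×_; _,_; ∃-syntax; proj₁)
open import Data.Sign.Base using (Sign; +; -)
import Data.Sign.Properties as Signₚ
open import Data.Sum.Base using (_⊎_; inj₁; inj₂)
open import Function.Base using (_∘_; flip)
open import Induction.WellFounded using (Acc; acc)
open import Relation.Binary.Definitions using (DecidableEquality)
open import Relation.Binary.PropositionalEquality using (_≡_; _≢_; refl; sym; trans; cong; cong₂; subst)
open import Relation.Binary.Rewriting using (StronglyNormalizing)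
open import Relation.Nullary.Decidable using (Dec; yes; no; map′; _×-dec_; _⊎-dec_; ¬?)
open import Relation.Nullary.Negation.Core using (¬_; contradiction)
open import Relation.Unary using (Decidable)

private
  variable
    n : ℕ

-- Decidability of reassociation

infix 4 _≟_ _≈?_

_≟_ : DecidableEquality Formula
ε a b   ≟ ε c d   = map′ (λ (p , q) → cong₂ ε p q) (λ { refl → refl , refl }) (a ℕₚ.≟ c ×-dec b ℕₚ.≟ d)
(A ∨ B) ≟ (C ∨ D) = map′ (λ (p , q) → cong₂ _∨_ p q) (λ { refl → refl , refl }) (A ≟ C ×-dec B ≟ D)
∼ A     ≟ ∼ B     = map′ (cong ∼_) (λ { refl → refl }) (A ≟ B)
ε _ _   ≟ (_ ∨ _) = no λ ()
ε _ _   ≟ ∼ _     = no λ ()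
(_ ∨ _) ≟ ε _ _   = no λ ()
(_ ∨ _) ≟ ∼ _     = no λ ()
∼ _     ≟ ε _ _   = no λ ()
∼ _     ≟ (_ ∨ _) = no λ ()

infixr 6 _▷_

-- Attaches `C` at the end of the right spine of `A`; on right-nested disjunctions this is
-- concatenation of their sequences of disjuncts.
_▷_ : Formula → Formula → Formula
ε a b   ▷ C = ε a b ∨ C
(A ∨ B) ▷ C = A ∨ (B ▷ C)
∼ A     ▷ C = ∼ A ∨ C

▷-≈ : ∀ A C → A ∨ C ≈ A ▷ C
▷-≈ (ε a b) C = ≈-refl
▷-≈ (A ∨ B) C = ≈-trans ∨-assoc (∨-cong ≈-refl (▷-≈ B C))
▷-≈ (∼ A)   C = ≈-refl

▷-assoc : ∀ A B C → (A ▷ B) ▷ C ≡ A ▷ (B ▷ C)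
▷-assoc (ε a b)  B C = refl
▷-assoc (A ∨ A′) B C = cong (A ∨_) (▷-assoc A′ B C)
▷-assoc (∼ A)    B C = refl

rightAssociate : Formula → Formula
rightAssociate (ε a b) = ε a b
rightAssociate (A ∨ B) = rightAssociate A ▷ rightAssociate B
rightAssociate (∼ A)   = ∼ rightAssociate A

≈-rightAssociate : ∀ A → A ≈ rightAssociate A
≈-rightAssociate (ε a b) = ≈-refl
≈-rightAssociate (A ∨ B) = ≈-trans (∨-cong (≈-rightAssociate A) (≈-rightAssociate B)) (▷-≈ _ _)
≈-rightAssociate (∼ A)   = ∼-cong (≈-rightAssociate A)

-- `▷` is associative up to equality, so reassociation disappears in the normal form and `≈` reduces
-- to syntactic equality.
rightAssociate-cong : A ≈ B → rightAssociate A ≡ rightAssociate B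
rightAssociate-cong ≈-refl               = refl
rightAssociate-cong (≈-sym e)            = sym (rightAssociate-cong e)
rightAssociate-cong (≈-trans e f)        = trans (rightAssociate-cong e) (rightAssociate-cong f)
rightAssociate-cong (∨-assoc {A} {B} {C}) = ▷-assoc (rightAssociate A) (rightAssociate B) (rightAssociate C)
rightAssociate-cong (∨-cong e f)         = cong₂ _▷_ (rightAssociate-cong e) (rightAssociate-cong f)
rightAssociate-cong (∼-cong e)           = cong ∼_ (rightAssociate-cong e)

_≈?_ : ∀ A B → Dec (A ≈ B)
A ≈? B = map′
  (λ eq → ≈-trans (≈-rightAssociate A) (subst (_≈ B) (sym eq) (≈-sym (≈-rightAssociate B))))
  rightAssociate-cong (rightAssociate A ≟ rightAssociate B)

-- Formulas of bounded weight

-- The maximum in the atomic case makes the weight of ε a c bounded by those of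
-- ε a b and ε b c.
weight : Formula → ℕ
weight (ε a b) = suc (a ⊔ b)
weight (A ∨ B) = suc (weight A ℕ.+ weight B)
weight (∼ A)   = suc (weight A)

weight-cong : A ≈ B → weight A ≡ weight B
weight-cong ≈-refl        = refl
weight-cong (≈-sym e)     = sym (weight-cong e)
weight-cong (≈-trans e f) = trans (weight-cong e) (weight-cong f)
weight-cong (∨-assoc {A} {B} {C}) = cong suc (trans
  (cong suc (ℕₚ.+-assoc (weight A) (weight B) (weight C)))
  (sym (ℕₚ.+-suc (weight A) (weight B ℕ.+ weight C))))
weight-cong (∨-cong e f)  = cong suc (cong₂ ℕ._+_ (weight-cong e) (weight-cong f))
weight-cong (∼-cong e)    = cong suc (weight-cong e)

weight-∨ˡ : ∀ A B → weight A < weight (A ∨ B)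
weight-∨ˡ A B = s≤s (ℕₚ.m≤m+n (weight A) (weight B))

weight-∨ʳ : ∀ A B → weight B < weight (A ∨ B)
weight-∨ʳ A B = s≤s (ℕₚ.m≤n+m (weight B) (weight A))

formulas : ℕ → List Formula
formulas zero    = []
formulas (suc n) =
  cartesianProductWith ε (upTo (suc n)) (upTo (suc n)) ++
  cartesianProductWith _∨_ (formulas n) (formulas n) ++
  map ∼_ (formulas n)

∈-formulas : ∀ A → weight A ≤ n → A ∈ formulas n
∈-formulas (ε a b) (s≤s le) = ∈-++⁺ˡ (∈-cartesianProductWith⁺ ε
  (∈-upTo⁺ (s≤s (ℕₚ.m⊔n≤o⇒m≤o a b le))) (∈-upTo⁺ (s≤s (ℕₚ.m⊔n≤o⇒n≤o a b le))))
∈-formulas {suc n} (A ∨ B) (s≤s le) =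
  ∈-++⁺ʳ (cartesianProductWith ε (upTo (suc n)) (upTo (suc n))) (∈-++⁺ˡ (∈-cartesianProductWith⁺ _∨_
    (∈-formulas A (ℕₚ.m+n≤o⇒m≤o (weight A) le)) (∈-formulas B (ℕₚ.m+n≤o⇒n≤o (weight A) le))))
∈-formulas {suc n} (∼ A) (s≤s le) =
  ∈-++⁺ʳ (cartesianProductWith ε (upTo (suc n)) (upTo (suc n)))
    (∈-++⁺ʳ (cartesianProductWith _∨_ (formulas n) (formulas n)) (∈-map⁺ ∼_ (∈-formulas A le)))

∃-bounded? : {P : Formula → Set} → Decidable P → (∀ {A} → P A → weight A ≤ n) → Dec (∃[ A ] P A)
∃-bounded? {n} P? bound =
  map′ satisfied (λ (A , p) → lose (∈-formulas A (bound p)) p) (any? P? (formulas n))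

∃-≈? : ∀ A {P : Formula → Set} → Decidable P → Dec (∃[ G ] (A ≈ G × P G))
∃-≈? A P? = ∃-bounded? (λ G → (A ≈? G) ×-dec P? G) (λ (e , _) → ℕₚ.≤-reflexive (sym (weight-cong e)))

-- Decidability of parthood and closedness

-- Within t A s B : B is a part of sign s of the part A of sign t.  Unlike Occ,
-- this relation is generated from the root of the larger formula.
data Within : Sign → Formula → Sign → Formula → Set where
  here : Within t A t A
  ∨ˡ   : Within + A s C → Within + (A ∨ B) s C
  ∨ʳ   : Within + B s C → Within + (A ∨ B) s C
  ∼₊   : Within - A s C → Within + (∼ A) s C
  ∼₋   : Within + A s C → Within - (∼ A) s C

Within-trans : ∀ {r} → Within r A s B → Within s B t C → Within r A t C
Within-trans here   q = q
Within-trans (∨ˡ p) q = ∨ˡ (Within-trans p q)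
Within-trans (∨ʳ p) q = ∨ʳ (Within-trans p q)
Within-trans (∼₊ p) q = ∼₊ (Within-trans p q)
Within-trans (∼₋ p) q = ∼₋ (Within-trans p q)

Occ⇒Within : Occ s B A → Within + A s B
Occ⇒Within here   = here
Occ⇒Within (∨ˡ p) = Within-trans (Occ⇒Within p) (∨ˡ here)
Occ⇒Within (∨ʳ p) = Within-trans (Occ⇒Within p) (∨ʳ here)
Occ⇒Within (∼₊ p) = Within-trans (Occ⇒Within p) (∼₊ here)
Occ⇒Within (∼₋ p) = Within-trans (Occ⇒Within p) (∼₋ here)

Occ-Within : Occ t B A → Within t B s C → Occ s C A
Occ-Within p here   = p
Occ-Within p (∨ˡ q) = Occ-Within (∨ˡ p) q
Occ-Within p (∨ʳ q) = Occ-Within (∨ʳ p) q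
Occ-Within p (∼₊ q) = Occ-Within (∼₊ p) q
Occ-Within p (∼₋ q) = Occ-Within (∼₋ p) q

-- Structural recursion on `A` is possible because `Within` descends from the root, whereas `Occ`
-- grows at the end of the path.
within? : ∀ t A s B → Dec (Within t A s B)
within? t A s B with t Signₚ.≟ s ×-dec A ≟ B
within? t A s B       | yes (refl , refl) = yes here
within? t (ε a b) s B | no neq = no λ { here → neq (refl , refl) }
within? + (A ∨ C) s B | no neq = map′
  (λ { (inj₁ p) → ∨ˡ p ; (inj₂ p) → ∨ʳ p })
  (λ { here → contradiction (refl , refl) neq ; (∨ˡ p) → inj₁ p ; (∨ʳ p) → inj₂ p })
  (within? + A s B ⊎-dec within? + C s B)
within? - (A ∨ C) s B | no neq = no λ { here → neq (refl , refl) }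
within? + (∼ A) s B   | no neq = map′ ∼₊
  (λ { here → contradiction (refl , refl) neq ; (∼₊ p) → p }) (within? - A s B)
within? - (∼ A) s B   | no neq = map′ ∼₋
  (λ { here → contradiction (refl , refl) neq ; (∼₋ p) → p }) (within? + A s B)

occ? : ∀ s B A → Dec (Occ s B A)
occ? s B A = map′ (Occ-Within here) Occ⇒Within (within? + A s B)

part? : ∀ s B A → Dec (Part s B A)
part? s B A = ∃-≈? A (occ? s B)

weight-occ : Occ s B A → weight B ≤ weight A
weight-occ here   = ℕₚ.≤-refl
weight-occ (∨ˡ {B} {C} p) = ℕₚ.≤-trans (ℕₚ.<⇒≤ (weight-∨ˡ B C)) (weight-occ p)
weight-occ (∨ʳ {B} {C} p) = ℕₚ.≤-trans (ℕₚ.<⇒≤ (weight-∨ʳ B C)) (weight-occ p)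
weight-occ (∼₊ p) = ℕₚ.≤-trans (ℕₚ.n≤1+n _) (weight-occ p)
weight-occ (∼₋ p) = ℕₚ.≤-trans (ℕₚ.n≤1+n _) (weight-occ p)

⊑⇒≤ : {p : Occ s B A} {q : Occ t C A} → p ⊑ q → weight B ≤ weight C
⊑⇒≤ ⊑-refl = ℕₚ.≤-refl
⊑⇒≤ (⊑-∨ˡ {B} {C} l) = ℕₚ.≤-trans (ℕₚ.<⇒≤ (weight-∨ˡ B C)) (⊑⇒≤ l)
⊑⇒≤ (⊑-∨ʳ {B} {C} l) = ℕₚ.≤-trans (ℕₚ.<⇒≤ (weight-∨ʳ B C)) (⊑⇒≤ l)
⊑⇒≤ (⊑-∼₊ l) = ℕₚ.≤-trans (ℕₚ.n≤1+n _) (⊑⇒≤ l)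
⊑⇒≤ (⊑-∼₋ l) = ℕₚ.≤-trans (ℕₚ.n≤1+n _) (⊑⇒≤ l)

⊑⇒≡⊎< : {p : Occ s B A} {q : Occ t C A} → p ⊑ q → s ≡ t ⊎ weight B < weight C
⊑⇒≡⊎< ⊑-refl = inj₁ refl
⊑⇒≡⊎< (⊑-∨ˡ {B} {C} l) = inj₂ (ℕₚ.<-≤-trans (weight-∨ˡ B C) (⊑⇒≤ l))
⊑⇒≡⊎< (⊑-∨ʳ {B} {C} l) = inj₂ (ℕₚ.<-≤-trans (weight-∨ʳ B C) (⊑⇒≤ l))
⊑⇒≡⊎< (⊑-∼₊ l) = inj₂ (⊑⇒≤ l)
⊑⇒≡⊎< (⊑-∼₋ l) = inj₂ (⊑⇒≤ l)

-- Proper nesting strictly lowers the weight, so nested occurrences of the same `B` coincide and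
-- then have the same sign. Hence `closed?` may look for the two occurrences independently.
opposite-signs⇒nonOverlapping : (p : Occ + B A) (q : Occ - B A) → NonOverlapping p q
opposite-signs⇒nonOverlapping p q = (λ l → absurd (λ ()) (⊑⇒≡⊎< l)) , (λ l → absurd (λ ()) (⊑⇒≡⊎< l))
  where
  absurd : s ≢ t → ¬ (s ≡ t ⊎ weight B < weight B)
  absurd s≢t (inj₁ s≡t) = s≢t s≡t
  absurd s≢t (inj₂ lt)  = ℕₚ.<-irrefl refl lt

closed? : ∀ A → Dec (Closed A)
closed? A = map′
  (λ (G , e , B , p , q) → B , G , e , p , q , opposite-signs⇒nonOverlapping p q)
  (λ (B , G , e , p , q , _) → G , e , B , p , q)
  (∃-≈? A λ G → ∃-bounded? (λ B → occ? + B G ×-dec occ? - B G) (weight-occ ∘ proj₁))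

-- Completed branches

-- Reassociation can destroy only disjunctions as parts, never atoms. Both directions are proved
-- together because of `≈-sym`, and for both signs `t` because of `∼-cong`.
atom-within : A ≈ B → Within t A s (ε a b) → Within t B s (ε a b)
atom-within˘ : A ≈ B → Within t B s (ε a b) → Within t A s (ε a b)

atom-within ≈-refl        p           = p
atom-within (≈-sym e)     p           = atom-within˘ e p
atom-within (≈-trans e f) p           = atom-within f (atom-within e p)
atom-within ∨-assoc       (∨ˡ (∨ˡ p)) = ∨ˡ p
atom-within ∨-assoc       (∨ˡ (∨ʳ p)) = ∨ʳ (∨ˡ p)
atom-within ∨-assoc       (∨ʳ p)      = ∨ʳ (∨ʳ p)
atom-within (∨-cong e f)  (∨ˡ p)      = ∨ˡ (atom-within e p)
atom-within (∨-cong e f)  (∨ʳ p)      = ∨ʳ (atom-within f p)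
atom-within (∼-cong e)    (∼₊ p)      = ∼₊ (atom-within e p)
atom-within (∼-cong e)    (∼₋ p)      = ∼₋ (atom-within e p)

atom-within˘ ≈-refl        p           = p
atom-within˘ (≈-sym e)     p           = atom-within e p
atom-within˘ (≈-trans e f) p           = atom-within˘ e (atom-within˘ f p)
atom-within˘ ∨-assoc       (∨ˡ p)      = ∨ˡ (∨ˡ p)
atom-within˘ ∨-assoc       (∨ʳ (∨ˡ p)) = ∨ˡ (∨ʳ p)
atom-within˘ ∨-assoc       (∨ʳ (∨ʳ p)) = ∨ʳ p
atom-within˘ (∨-cong e f)  (∨ˡ p)      = ∨ˡ (atom-within˘ e p)
atom-within˘ (∨-cong e f)  (∨ʳ p)      = ∨ʳ (atom-within˘ f p)
atom-within˘ (∼-cong e)    (∼₊ p)      = ∼₊ (atom-within˘ e p)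
atom-within˘ (∼-cong e)    (∼₋ p)      = ∼₋ (atom-within˘ e p)

⊑-atom : {p : Occ s B A} {q : Occ t (ε a b) A} → p ⊑ q → B ≡ ε a b
⊑-atom ⊑-refl = refl
⊑-atom (⊑-∨ˡ l) with () ← ⊑-atom l
⊑-atom (⊑-∨ʳ l) with () ← ⊑-atom l
⊑-atom (⊑-∼₊ l) with () ← ⊑-atom l
⊑-atom (⊑-∼₋ l) with () ← ⊑-atom l

-- The two parts may be witnessed in different trees; the second is carried over to the tree of the
-- first. Nothing but an atom itself lies inside it, so distinct atoms cannot overlap.
distinct-atoms : ∀ {d} → ε a b ≢ ε c d → Part s (ε a b) A → Part t (ε c d) A →
                 ∃[ G ] (A ≈ G × Occ₂ s (ε a b) t (ε c d) G)
distinct-atoms neq (G , e , p) (G′ , e′ , q) =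
  G , e , p , Occ-Within here (atom-within (≈-trans (≈-sym e′) e) (Occ⇒Within q)) ,
  neq ∘ ⊑-atom , neq ∘ sym ∘ ⊑-atom

irreducible⇒part : ¬ Closed H → ¬ NormallyReducible H →
                   H ≈ G → Rule G Ds → Any (λ D → Part - D H) Ds
irreducible⇒part {H} {Ds = Ds} open′ irr e r with any? (λ D → part? - D H) Ds
... | yes p = p
... | no ¬p = contradiction (_ , _ , e , r , open′ , ¬Any⇒All¬ _ ¬p) irr

irreducible⇒hintikka : ¬ Closed H → ¬ NormallyReducible H → Hintikka H
irreducible⇒hintikka {H} open′ irr = record
  { notClosed = open′
  ; ∨-neg     = λ { B C (G , e , p) → either (rule e (∨₋ p)) }
  ; ε₁-neg    = λ { a b (G , e , p) → single (rule e (ε₁ p)) }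
  ; ε₂-neg    = ε₂-neg
  ; ε₃b-neg   = ε₃b-neg
  }
  where
  rule : H ≈ G → Rule G Ds → Any (λ D → Part - D H) Ds
  rule = irreducible⇒part open′ irr

  either : {P : Formula → Set} → Any P (B ∷ C ∷ []) → P B ⊎ P C
  either (here p)         = inj₁ p
  either (there (here p)) = inj₂ p

  single : {P : Formula → Set} → Any P [ B ] → P B
  single (here p) = p

  ε₂-neg : ∀ a b c → Part - (ε a b) H → Part - (ε b c) H → Part - (ε a c) H
  ε₂-neg a b c p q with ε a b ≟ ε b c
  -- Here `a`, `b` and `c` coincide, so the conclusion is the premise itself. The rule might not
  -- apply, as there may be only one occurrence.
  ... | yes refl = p
  ... | no neq with _ , e , pq ← distinct-atoms neq p q = single (rule e (ε₂ pq))

  ε₃b-neg : ∀ a b → Part - (ε a b) H → Part - (ε b b) H → Part - (ε b a) H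
  ε₃b-neg a b p q with ε a b ≟ ε b b
  ... | yes refl = p
  ... | no neq with _ , e , pq ← distinct-atoms neq p q = single (rule e (ε₃b pq))

-- Termination

-- Every negative part lies within some negated disjunct, whose body bounds its weight. Unlike
-- `weight`, this bound does not grow when `∼ D` is appended with `weight D` below it.
negWeight : Formula → ℕ
negWeight (ε a b) = 0
negWeight (A ∨ B) = negWeight A ⊔ negWeight B
negWeight (∼ A)   = weight A

negWeight-cong : A ≈ B → negWeight A ≡ negWeight B
negWeight-cong ≈-refl        = refl
negWeight-cong (≈-sym e)     = sym (negWeight-cong e)
negWeight-cong (≈-trans e f) = trans (negWeight-cong e) (negWeight-cong f)
negWeight-cong (∨-assoc {A} {B} {C}) = ℕₚ.⊔-assoc (negWeight A) (negWeight B) (negWeight C)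
negWeight-cong (∨-cong e f)  = cong₂ _⊔_ (negWeight-cong e) (negWeight-cong f)
negWeight-cong (∼-cong e)    = weight-cong e

negWeight≤weight : ∀ A → negWeight A ≤ weight A
negWeight≤weight (ε a b) = z≤n
negWeight≤weight (A ∨ B) = ℕₚ.≤-trans
  (ℕₚ.⊔-mono-≤ (negWeight≤weight A) (negWeight≤weight B))
  (ℕₚ.≤-trans (ℕₚ.m⊔n≤m+n (weight A) (weight B)) (ℕₚ.n≤1+n _))
negWeight≤weight (∼ A)   = ℕₚ.n≤1+n _

positive⇒negWeight≤ : Occ + B A → negWeight B ≤ negWeight A
negative⇒weight≤ : Occ - B A → weight B ≤ negWeight A

positive⇒negWeight≤ here   = ℕₚ.≤-refl
positive⇒negWeight≤ (∨ˡ p) = ℕₚ.≤-trans (ℕₚ.m≤m⊔n _ _) (positive⇒negWeight≤ p)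
positive⇒negWeight≤ (∨ʳ {B} p) = ℕₚ.≤-trans (ℕₚ.m≤n⊔m (negWeight B) _) (positive⇒negWeight≤ p)
positive⇒negWeight≤ (∼₋ {B} p) =
  ℕₚ.≤-trans (negWeight≤weight B) (ℕₚ.≤-trans (ℕₚ.n≤1+n _) (negative⇒weight≤ p))

negative⇒weight≤ (∼₊ p) = positive⇒negWeight≤ p

rule⇒weight≤ : Rule G Ds → All (λ D → weight D ≤ negWeight G) Ds
rule⇒weight≤ (∨₋ {B} {C} p) =
  ℕₚ.≤-trans (ℕₚ.<⇒≤ (weight-∨ˡ B C)) (negative⇒weight≤ p) ∷
  ℕₚ.≤-trans (ℕₚ.<⇒≤ (weight-∨ʳ B C)) (negative⇒weight≤ p) ∷ []
rule⇒weight≤ (ε₁ {a} {b} p) =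
  let le = negative⇒weight≤ p ; a≤ = ℕₚ.m⊔n≤o⇒m≤o (suc a) (suc b) le in ℕₚ.⊔-lub a≤ a≤ ∷ []
rule⇒weight≤ (ε₂ {a} {b} {c} (p , q , _)) = ℕₚ.⊔-lub
  (ℕₚ.m⊔n≤o⇒m≤o (suc a) (suc b) (negative⇒weight≤ p))
  (ℕₚ.m⊔n≤o⇒n≤o (suc b) (suc c) (negative⇒weight≤ q)) ∷ []
rule⇒weight≤ (ε₃b {a} {b} (p , _)) = let le = negative⇒weight≤ p in
  ℕₚ.⊔-lub (ℕₚ.m⊔n≤o⇒n≤o (suc a) (suc b) le) (ℕₚ.m⊔n≤o⇒m≤o (suc a) (suc b) le) ∷ []

part-weaken : A ≈ G → Part s B A → Part s B (G ∨ D)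
part-weaken e (G′ , e′ , p) =
  G′ ∨ _ , ∨-cong (≈-trans (≈-sym e) e′) ≈-refl , Occ-Within here (∨ˡ (Occ⇒Within p))

SN : Tableau A → Set
SN = Acc (flip _⟶_)

SNₐ : All (λ D → Tableau (G ∨ ∼ D)) Ds → Set
SNₐ = Acc (flip _⟶ₐ_)

SNₐ-[] : SNₐ {G} []
SNₐ-[] = acc λ ()

-- A step changes exactly one component, so one of the two accessibility proofs shrinks while the
-- other is kept.
SNₐ-∷ : {T : Tableau (G ∨ ∼ D)} {ts : All (λ D → Tableau (G ∨ ∼ D)) Ds} →
        SN T → SNₐ ts → SNₐ (T ∷ ts)
SNₐ-∷ (acc x) (acc y) = acc λ
  { (here r)  → SNₐ-∷ (x r) (acc y)
  ; (there r) → SNₐ-∷ (acc x) (y r)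
  }

SN-node : {e : A ≈ G} {r : Rule G Ds} {ts : All (λ D → Tableau (G ∨ ∼ D)) Ds} →
          SNₐ ts → SN (node e r ts)
SN-node (acc x) = acc λ { (below r) → SN-node (x r) }

SNₐ-leaves : All (λ D → SN {G ∨ ∼ D} leaf) Ds → SNₐ {G} (universal (λ _ → leaf) Ds)
SNₐ-leaves []       = SNₐ-[]
SNₐ-leaves (x ∷ xs) = SNₐ-∷ x (SNₐ-leaves xs)

-- The list contains every formula that may still be appended on the branch.
SN-leaf-bounded : ∀ k (unused : List Formula) → length unused < k → negWeight A ≤ n →
                  (∀ D → weight D ≤ n → ¬ Part - D A → D ∈ unused) → SN {A} leaf
SN-leaf-bounded {A} {n} (suc k) unused (s≤s len) bound complete = acc λ
  { (extend e r (_ , new)) →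
      SN-node (SNₐ-leaves (All.zipWith (λ (D≤G , D∉A) → next e D≤G D∉A) (rule⇒weight≤ r , new))) }
  where
  next : A ≈ G → weight D ≤ negWeight G → ¬ Part - D A → SN {G ∨ ∼ D} leaf
  next {G} {D} e D≤G D∉A = SN-leaf-bounded k (filter unused? unused)
    (ℕₚ.<-≤-trans shorter len) (ℕₚ.⊔-lub G≤n D≤n)
    -- Negative parts persist along the branch, so whatever is still absent after the step was
    -- absent before and thus listed.
    λ E E≤n E∉ → ∈-filter⁺ unused? (complete E E≤n (E∉ ∘ part-weaken e)) E∉
    where
    G≤n : negWeight G ≤ n
    G≤n = subst (_≤ n) (negWeight-cong e) bound

    D≤n : weight D ≤ n
    D≤n = ℕₚ.≤-trans D≤G G≤n

    unused? : Decidable (λ E → ¬ Part - E (G ∨ ∼ D))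
    unused? E = ¬? (part? - E (G ∨ ∼ D))

    shorter : length (filter unused? unused) < length unused
    -- The appended `D` was listed and is now a negative part, so the filter removes it.
    shorter = filter-notAll unused? unused
      (lose (complete D D≤n D∉A) (λ ¬p → ¬p (_ , ≈-refl , ∼₊ (∨ʳ here))))

SN-leaf : SN {A} leaf
SN-leaf {A} = SN-leaf-bounded _ (formulas (negWeight A)) ℕₚ.≤-refl ℕₚ.≤-refl
  (λ D le _ → ∈-formulas D le)

-- Steps only extend leaves and keep existing nodes, so induction on the tree reduces the claim to
-- `SN-leaf`.
strongly-normalizing : (T : Tableau A) → SN T
strongly-normalizingₐ : (ts : All (λ D → Tableau (G ∨ ∼ D)) Ds) → SNₐ ts

strongly-normalizing leaf          = SN-leaf
strongly-normalizing (node e r ts) = SN-node (strongly-normalizingₐ ts)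

strongly-normalizingₐ []       = SNₐ-[]
strongly-normalizingₐ (T ∷ ts) = SNₐ-∷ (strongly-normalizing T) (strongly-normalizingₐ ts)

theorem2p1 : (A : Formula) →
    StronglyNormalizing (_⟶_ {A})
    × ((T : Tableau A) → CompletedNormal T → (H : Formula) → BranchEnd H T → Closed H ⊎ Hintikka H)
theorem2p1 A = strongly-normalizing , ends
  where
  ends : (T : Tableau A) → CompletedNormal T → (H : Formula) → BranchEnd H T → Closed H ⊎ Hintikka H
  ends T (_ , completed) H end with closed? H
  ... | yes closed = inj₁ closed
  ... | no  open′  = inj₂ (irreducible⇒hintikka open′ (completed H end))
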